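{- Let $G$ be a finite simple connected graph and let $S,S'\subseteq V(G)$ with $2\le |S|$ and $S\subset S'$. If $G$ contains $k$ completely independent $S'$-Steiner trees, then $G$ contains $k$ completely independent $S$-Steiner trees. In particular $\kappa^*_G(S)\geq \kappa^*_G(S')$.
   Context: For $S\subseteq V(G)$ with $|S|\ge 2$, an $S$-Steiner tree of $G$ is a subtree $T$ of $G$ with $S\subseteq V(T)$ all of whose leaves belong to $S$. A family of $S$-Steiner trees $T_1,\dots,T_k$ is completely independent if for all $1\le p<q\le k$: $E(T_p)\cap E(T_q)=\emptyset$, $V(T_p)\cap V(T_q)=S$, and for any two vertices $x_1,x_2\in S$ the $(x_1,x_2)$-paths in $T_p$ and in $T_q$ are internally disjoint. $\kappa^*_G(S)$ is the maximum number of $S$-Steiner trees in a completely independent family in $G$. -}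

module Defs where

open import Data.Fin.Base using (Fin; zero; suc; toℕ; fromℕ<; _<_)
open import Data.Fin.Properties
  using (_≟_; _<?_; all?; any?; injective⇒≤; toℕ-fromℕ<; <-cmp; suc-injective)
open import Data.Fin.Subset using (Subset; _∈_; _⊆_; _∩_; ∣_∣; inside; outside)
open import Data.Fin.Subset.Properties using (_∈?_; _⊆?_; anySubset?)
open import Data.List.Base using (List; []; _∷_; length; head; last)
import Data.List.Base as List
open import Data.List.Membership.Propositional using () renaming (_∈_ to _∈ˡ_)
open import Data.List.Membership.Propositional.Properties using (∈-lookup)
open import Data.List.Relation.Unary.All as All using (All; []; _∷_)
open import Data.List.Relation.Unary.AllPairs using ([]; _∷_)
open import Data.List.Relation.Unary.Linked using (Linked; _∷_; linked?)
open import Data.List.Relation.Unary.Unique.Propositional using (Unique)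
import Data.List.Relation.Unary.Unique.DecPropositional as UniqueDec
import Data.List.Membership.DecPropositional as MembershipDec
open import Data.Maybe.Base using (just)
import Data.Maybe.Properties as Maybe
open import Data.Nat.Base using (ℕ; zero; suc; _≤_; s≤s)
open import Data.Nat.Properties as ℕ using (_≤?_)
open import Data.Product.Base using (Σ; ∃; ∃₂; ∃-syntax; _×_; _,_; proj₁; proj₂)
open import Data.Unit.Base using (tt)
open import Data.Vec.Base using (Vec; []; _∷_; lookup; toList; fromList; here; there)
open import Data.Vec.Properties using (toList∘fromList; ≡-dec)
import Data.Bool.Properties as Bool
open import Function.Base using (_∘_)
open import Level using (0ℓ)
open import Relation.Binary.Definitions using (tri<; tri≈; tri>)
open import Relation.Binary.PropositionalEquality
  using (_≡_; _≢_; refl; sym; cong; subst)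
open import Relation.Nullary.Decidable
  using (Dec; yes; no; map′; ¬?; _×-dec_; _→-dec_; decidable-stable)
open import Relation.Nullary.Negation using (¬_; contradiction)
open import Relation.Unary using (Pred; Decidable)

------------------------------------------------------------------------
-- Finite simple graphs

-- Vertices are drawn from the labels Fin n, but need not exhaust them, so
-- that a graph and its subgraphs have the same type.  `lookup adj x` is the
-- neighbourhood of x.  Being simple is the separate predicate IsSimple,
-- which keeps `Graph n` a finite type of plain data.

record Graph (n : ℕ) : Set where
  constructor mkGraph
  field
    V   : Subset n
    adj : Vec (Subset n) n

open Graph public

private variable
  n : ℕ

Edge : Graph n → Fin n → Fin n → Set
Edge G x y = y ∈ lookup (adj G) x

record IsSimple (G : Graph n) : Set where
  field
    edge⇒∈V : ∀ {x y} → Edge G x y → x ∈ V G × y ∈ V G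
    edge-sym : ∀ {x y} → Edge G x y → Edge G y x
    no-loops : ∀ {x} → ¬ Edge G x x

record IsSubgraph (H G : Graph n) : Set where
  field
    V⊆ : V H ⊆ V G
    E⊆ : ∀ {x y} → Edge H x y → Edge G x y

-- A path is the list of all its vertices, both ends included.

record IsPath (G : Graph n) (x y : Fin n) (p : List (Fin n)) : Set where
  field
    vertices : All (_∈ V G) p
    edges    : Linked (Edge G) p
    distinct : Unique p
    start    : head p ≡ just x
    end      : last p ≡ just y

Internal : Fin n → Fin n → List (Fin n) → Fin n → Set
Internal x y p z = z ∈ˡ p × z ≢ x × z ≢ y

Connected : Graph n → Set
Connected G = ∀ x y → x ∈ V G → y ∈ V G → ∃[ p ] IsPath G x y p

-- A cycle is a path on at least three vertices whose last vertex is
-- adjacent to its first.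

Acyclic : Graph n → Set
Acyclic G = ∀ x y p → IsPath G x y p → 3 ≤ length p → ¬ Edge G y x

degree : Graph n → Fin n → ℕ
degree G x = ∣ lookup (adj G) x ∣

IsLeaf : Graph n → Fin n → Set
IsLeaf G x = x ∈ V G × degree G x ≡ 1

record IsTree (T : Graph n) : Set where
  field
    simple    : IsSimple T
    connected : Connected T
    acyclic   : Acyclic T

------------------------------------------------------------------------
-- Steiner trees

record IsSteinerTree (G : Graph n) (S : Subset n) (T : Graph n) : Set where
  field
    subgraph : IsSubgraph T G
    tree     : IsTree T
    S⊆V      : S ⊆ V T
    leaf⇒∈S  : ∀ x → IsLeaf T x → x ∈ S

record IndependentPair (S : Subset n) (T U : Graph n) : Set where
  field
    edge-disjoint : ∀ x y → ¬ (Edge T x y × Edge U x y)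
    V∩V≡S         : V T ∩ V U ≡ S
    internally-disjoint :
      ∀ x₁ x₂ → x₁ ∈ S → x₂ ∈ S →
      ∀ p q → IsPath T x₁ x₂ p → IsPath U x₁ x₂ q →
      ∀ z → ¬ (Internal x₁ x₂ p z × Internal x₁ x₂ q z)

CompletelyIndependent : ∀ {k} → Subset n → Vec (Graph n) k → Set
CompletelyIndependent S Ts =
  ∀ i j → i < j → IndependentPair S (lookup Ts i) (lookup Ts j)

HasIndependentSteinerTrees : Graph n → Subset n → ℕ → Set
HasIndependentSteinerTrees {n} G S k =
  Σ (Vec (Graph n) k) λ Ts →
    (∀ i → IsSteinerTree G S (lookup Ts i)) × CompletelyIndependent S Ts

IsMaximum : Pred ℕ 0ℓ → ℕ → Set
IsMaximum P m = P m × (∀ k → P k → k ≤ m)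

------------------------------------------------------------------------
-- Decidability of the notions above

private variable
  A : Set

Searchable : Set → Set₁
Searchable A = ∀ {P : Pred A 0ℓ} → Decidable P → Dec (∃ P)

searchVec : Searchable A → ∀ k → Searchable (Vec A k)
searchVec s zero    P? = map′ ([] ,_) (λ { ([] , p) → p }) (P? [])
searchVec s (suc k) P? =
  map′ (λ { (x , xs , p) → (x ∷ xs) , p }) (λ { ((x ∷ xs) , p) → x , xs , p })
       (s λ x → searchVec s k λ xs → P? (x ∷ xs))

searchGraph : Searchable (Graph n)
searchGraph {n} P? =
  map′ (λ { (v , a , p) → mkGraph v a , p }) (λ { (mkGraph v a , p) → v , a , p })
       (anySubset? λ v → searchVec anySubset? n λ a → P? (mkGraph v a))

edge? : (G : Graph n) → ∀ x y → Dec (Edge G x y)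
edge? G x y = y ∈? lookup (adj G) x

isSimple? : (G : Graph n) → Dec (IsSimple G)
isSimple? G =
  map′ (λ { (e , s , l) → record
              { edge⇒∈V  = λ {x} {y} → e x y
              ; edge-sym = λ {x} {y} → s x y
              ; no-loops = λ {x} → l x } })
       (λ i → let open IsSimple i in
              (λ _ _ → edge⇒∈V) , (λ _ _ → edge-sym) , (λ _ → no-loops))
       ( all? (λ x → all? λ y → edge? G x y →-dec (x ∈? V G ×-dec y ∈? V G))
       ×-dec all? (λ x → all? λ y → edge? G x y →-dec edge? G y x)
       ×-dec all? (λ x → ¬? (edge? G x x)))

isSubgraph? : (H G : Graph n) → Dec (IsSubgraph H G)
isSubgraph? H G =
  map′ to from
       (V H ⊆? V G ×-dec all? λ x → all? λ y → edge? H x y →-dec edge? G x y)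
  where
  Conditions = V H ⊆ V G × (∀ x y → Edge H x y → Edge G x y)

  to : Conditions → IsSubgraph H G
  to (v , e) = record { V⊆ = v ; E⊆ = e _ _ }

  from : IsSubgraph H G → Conditions
  from s = IsSubgraph.V⊆ s , λ _ _ → IsSubgraph.E⊆ s

isPath? : (G : Graph n) → ∀ x y p → Dec (IsPath G x y p)
isPath? G x y p =
  map′ (λ { (v , e , d , s , t) → record
              { vertices = v ; edges = e ; distinct = d ; start = s ; end = t } })
       (λ i → let open IsPath i in vertices , edges , distinct , start , end)
       ( All.all? (_∈? V G) p
       ×-dec linked? (edge? G) p
       ×-dec UniqueDec.unique? _≟_ p
       ×-dec Maybe.≡-dec _≟_ (head p) (just x)
       ×-dec Maybe.≡-dec _≟_ (last p) (just y))

unique-lookup-injective : {xs : List A} → Unique xs →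
                          ∀ {i j} → List.lookup xs i ≡ List.lookup xs j → i ≡ j
unique-lookup-injective (_ ∷ _)  {zero}  {zero}  _  = refl
unique-lookup-injective (x∉ ∷ _) {zero}  {suc j} eq =
  contradiction eq (All.lookup x∉ (∈-lookup j))
unique-lookup-injective (x∉ ∷ _) {suc i} {zero}  eq =
  contradiction (sym eq) (All.lookup x∉ (∈-lookup i))
unique-lookup-injective (_ ∷ u)  {suc i} {suc j} eq =
  cong suc (unique-lookup-injective u eq)

unique⇒length≤ : {p : List (Fin n)} → Unique p → length p ≤ n
unique⇒length≤ u = injective⇒≤ (unique-lookup-injective u)

-- A path has at most n vertices, so paths can be searched exhaustively.

anyPath? : (G : Graph n) → ∀ x y {P : Pred (List (Fin n)) 0ℓ} → Decidable P →
           Dec (∃[ p ] IsPath G x y p × P p)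
anyPath? {n} G x y {P} P? =
  map′ (λ { (_ , v , w) → toList v , w }) bounded
       (any? λ (l : Fin (suc n)) → searchVec any? (toℕ l) λ v → good? (toList v))
  where
  Good : Pred (List (Fin n)) 0ℓ
  Good p = IsPath G x y p × P p

  good? : Decidable Good
  good? p = isPath? G x y p ×-dec P? p

  bounded : ∃ Good → ∃ λ (l : Fin (suc n)) → ∃ λ (v : Vec (Fin n) (toℕ l)) → Good (toList v)
  bounded (p , w) =
    fromℕ< l< ,
    subst (λ m → ∃ λ (v : Vec (Fin n) m) → Good (toList v)) (sym (toℕ-fromℕ< l<))
          (fromList p , subst Good (sym (toList∘fromList p)) w)
    where l< = s≤s (unique⇒length≤ (IsPath.distinct (proj₁ w)))

allPaths? : (G : Graph n) → ∀ x y {P : Pred (List (Fin n)) 0ℓ} → Decidable P →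
            Dec (∀ p → IsPath G x y p → P p)
allPaths? G x y P? =
  map′ (λ ¬∃¬ p w → decidable-stable (P? p) λ ¬Pp → ¬∃¬ (p , w , ¬Pp))
       (λ f → λ { (p , w , ¬Pp) → ¬Pp (f p w) })
       (¬? (anyPath? G x y (¬? ∘ P?)))

connected? : (G : Graph n) → Dec (Connected G)
connected? G = all? λ x → all? λ y →
  (x ∈? V G) →-dec ((y ∈? V G) →-dec
    map′ (λ { (p , w , _) → p , w }) (λ { (p , w) → p , w , tt })
         (anyPath? G x y (λ _ → yes tt)))

acyclic? : (G : Graph n) → Dec (Acyclic G)
acyclic? G = all? λ x → all? λ y →
  allPaths? G x y λ p → (3 ≤? length p) →-dec ¬? (edge? G y x)

isTree? : (T : Graph n) → Dec (IsTree T)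
isTree? T =
  map′ (λ { (s , c , a) → record { simple = s ; connected = c ; acyclic = a } })
       (λ t → let open IsTree t in simple , connected , acyclic)
       (isSimple? T ×-dec connected? T ×-dec acyclic? T)

isLeaf? : (G : Graph n) → Decidable (IsLeaf G)
isLeaf? G x = x ∈? V G ×-dec degree G x ℕ.≟ 1

isSteinerTree? : (G : Graph n) (S : Subset n) → Decidable (IsSteinerTree G S)
isSteinerTree? G S T =
  map′ to from
       ( isSubgraph? T G
       ×-dec isTree? T
       ×-dec S ⊆? V T
       ×-dec all? (λ x → isLeaf? T x →-dec x ∈? S))
  where
  Conditions = IsSubgraph T G × IsTree T × S ⊆ V T × (∀ x → IsLeaf T x → x ∈ S)

  to : Conditions → IsSteinerTree G S T
  to (g , t , s , l) = record { subgraph = g ; tree = t ; S⊆V = s ; leaf⇒∈S = l }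

  from : IsSteinerTree G S T → Conditions
  from i = subgraph , tree , S⊆V , leaf⇒∈S
    where open IsSteinerTree i

internal? : (x y : Fin n) (p : List (Fin n)) → Decidable (Internal x y p)
internal? x y p z = MembershipDec._∈?_ _≟_ z p ×-dec ¬? (z ≟ x) ×-dec ¬? (z ≟ y)

independentPair? : (S : Subset n) (T U : Graph n) → Dec (IndependentPair S T U)
independentPair? S T U =
  map′ (λ { (e , v , i) → record
              { edge-disjoint = e ; V∩V≡S = v
              ; internally-disjoint = λ x y x∈ y∈ p q wp wq → i x y x∈ y∈ p wp q wq } })
       (λ r → let open IndependentPair r in
              edge-disjoint , V∩V≡S ,
              λ x y x∈ y∈ p wp q wq → internally-disjoint x y x∈ y∈ p q wp wq)
       ( all? (λ x → all? λ y → ¬? (edge? T x y ×-dec edge? U x y))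
       ×-dec ≡-dec Bool._≟_ (V T ∩ V U) S
       ×-dec all? (λ x → all? λ y → (x ∈? S) →-dec ((y ∈? S) →-dec
               allPaths? T x y λ p → allPaths? U x y λ q →
                 all? λ z → ¬? (internal? x y p z ×-dec internal? x y q z))))

hasIndependentSteinerTrees? : (G : Graph n) (S : Subset n) →
                              Decidable (HasIndependentSteinerTrees G S)
hasIndependentSteinerTrees? G S k = searchVec searchGraph k λ Ts →
  all? (λ i → isSteinerTree? G S (lookup Ts i))
  ×-dec all? (λ i → all? λ j →
          (i <? j) →-dec independentPair? S (lookup Ts i) (lookup Ts j))

------------------------------------------------------------------------
-- κ*

-- Fix x in S.  As |S| ≥ 2, x has a neighbour in each tree of the family,
-- and edge-disjointness makes these neighbours distinct.  So a family has
-- at most n trees.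

1≤∣p∣⇒nonempty : (p : Subset n) → 1 ≤ ∣ p ∣ → ∃ (_∈ p)
1≤∣p∣⇒nonempty (inside  ∷ p) _ = zero , here
1≤∣p∣⇒nonempty (outside ∷ p) h with x , x∈ ← 1≤∣p∣⇒nonempty p h = suc x , there x∈

2≤∣p∣⇒distinct : (p : Subset n) → 2 ≤ ∣ p ∣ → ∃₂ λ x y → x ∈ p × y ∈ p × x ≢ y
2≤∣p∣⇒distinct (inside  ∷ p) (s≤s h)
  with y , y∈ ← 1≤∣p∣⇒nonempty p h = zero , suc y , here , there y∈ , λ ()
2≤∣p∣⇒distinct (outside ∷ p) h
  with x , y , x∈ , y∈ , x≢y ← 2≤∣p∣⇒distinct p h =
  suc x , suc y , there x∈ , there y∈ , x≢y ∘ suc-injective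

path⇒neighbour : {G : Graph n} {x y : Fin n} {p : List (Fin n)} →
                 x ≢ y → IsPath G x y p → ∃ (Edge G x)
path⇒neighbour {p = []} _ w with () ← IsPath.start w
path⇒neighbour {p = _ ∷ []} x≢y w with refl ← IsPath.start w | refl ← IsPath.end w =
  contradiction refl x≢y
path⇒neighbour {p = _ ∷ z ∷ _} _ w with refl ← IsPath.start w | e ∷ _ ← IsPath.edges w =
  z , e

family-size≤ : (G : Graph n) (S : Subset n) → 2 ≤ ∣ S ∣ →
               ∀ k → HasIndependentSteinerTrees G S k → k ≤ n
family-size≤ {n} G S 2≤∣S∣ k (Ts , steiner , indep)
  with x , y , x∈S , y∈S , x≢y ← 2≤∣p∣⇒distinct S 2≤∣S∣ = injective⇒≤ injective
  where
  neighbour : ∀ i → ∃ (Edge (lookup Ts i) x)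
  neighbour i = path⇒neighbour x≢y (proj₂ (connected x y (S⊆V x∈S) (S⊆V y∈S)))
    where open IsSteinerTree (steiner i); open IsTree tree

  clash : ∀ {i j} → i < j → proj₁ (neighbour i) ≢ proj₁ (neighbour j)
  clash {i} {j} i<j eq = IndependentPair.edge-disjoint (indep i j i<j) x _
    (proj₂ (neighbour i) , subst (Edge (lookup Ts j) x) (sym eq) (proj₂ (neighbour j)))

  injective : ∀ {i j} → proj₁ (neighbour i) ≡ proj₁ (neighbour j) → i ≡ j
  injective {i} {j} eq with <-cmp i j
  ... | tri< i<j _ _ = contradiction eq (clash i<j)
  ... | tri≈ _ i≡j _ = i≡j
  ... | tri> _ _ j<i = contradiction (sym eq) (clash j<i)

maximum : {P : Pred ℕ 0ℓ} → Decidable P → P 0 →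
          ∀ b → (∀ k → P k → k ≤ b) → ∃ (IsMaximum P)
maximum     P? P0 zero    P≤b = 0 , P0 , P≤b
maximum {P} P? P0 (suc b) P≤b with P? (suc b)
... | yes Pb = suc b , Pb , P≤b
... | no ¬Pb = maximum P? P0 b λ k Pk →
  ℕ.≤-pred (ℕ.≤∧≢⇒< (P≤b k Pk) λ k≡1+b → ¬Pb (subst P k≡1+b Pk))

κ*-maximum : (G : Graph n) (S : Subset n) → 2 ≤ ∣ S ∣ →
             ∃ (IsMaximum (HasIndependentSteinerTrees G S))
κ*-maximum {n} G S 2≤∣S∣ =
  maximum (hasIndependentSteinerTrees? G S) ([] , (λ ()) , λ ()) n
          (family-size≤ G S 2≤∣S∣)

κ* : (G : Graph n) (S : Subset n) → 2 ≤ ∣ S ∣ → ℕ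
κ* G S 2≤∣S∣ = proj₁ (κ*-maximum G S 2≤∣S∣)

{-# OPTIONS --safe #-}

-- Delete leaves outside S from each S′-Steiner tree until every leaf lies in S.
-- Suppose z ∉ S survives in two of the pruned trees T and U.  It is not a leaf,
-- so following two of its edges onwards until S is met shows that T − z
-- separates two vertices of S, and likewise U − z.  Two equivalence relations
-- on S neither of which is total cannot cover S × S, so some x, y ∈ S are
-- separated by z in both trees.  Then z is internal to the (x,y)-paths of
-- both, although these were internally disjoint in the original trees.

module Submission where

open import Data.Fin.Base using (Fin; zero; suc)
open import Data.Fin.Properties using (_≟_; any?)
open import Data.Fin.Subset using (Subset; _∈_; _∉_; _⊆_; _⊂_; _∩_; _-_; ∣_∣; ⊥)
open import Data.Fin.Subset.Properties
  using (_∈?_; ∉⊥; p─q⊆p; x∈p∧x≢y⇒x∈p-y; x∈p⇒∣p-x∣<∣p∣; ⊆-antisym; x∈p∩q⁺; x∈p∩q⁻;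
         p⊆q⇒∣p∣≤∣q∣)
open import Data.List.Base using (List; []; _∷_; length; last)
open import Data.List.Membership.Propositional using () renaming (_∈_ to _∈ˡ_; _∉_ to _∉ˡ_)
import Data.List.Membership.DecPropositional as MembershipDec
open import Data.List.Relation.Unary.All as All using ([]; _∷_)
open import Data.List.Relation.Unary.All.Properties using (¬Any⇒All¬; All¬⇒¬Any)
open import Data.List.Relation.Unary.AllPairs using ([]; _∷_)
open import Data.List.Relation.Unary.Any using (here; there)
open import Data.List.Relation.Unary.Linked as Linked using (Linked; []; [-]; _∷_)
open import Data.List.Relation.Unary.Unique.Propositional using (Unique)
open import Data.Maybe.Base using (just)
open import Data.Nat.Base as ℕ using (ℕ; zero; suc; _+_; _≤_; _≥_; z≤n; s≤s)
open import Data.Nat.Induction using (Acc; acc; <-wellFounded)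
open import Data.Nat.Properties as ℕ using (≤-trans)
open import Data.Product.Base using (∃₂; ∃-syntax; _×_; _,_; proj₁; proj₂)
open import Data.Vec.Base using (_∷_; here; there; lookup; tabulate)
open import Data.Vec.Properties using (lookup∘tabulate)
open import Function.Base using (_∘_; _$_)
open import Relation.Binary.Construct.Closure.ReflexiveTransitive
  using (Star; ε; _◅_; _◅◅_; reverse)
open import Relation.Binary.Core using (Rel)
open import Relation.Binary.Definitions using (Symmetric; Transitive)
open import Relation.Binary.PropositionalEquality
  using (_≡_; _≢_; refl; sym; subst; ≢-sym)
open import Relation.Nullary.Decidable
  using (Dec; yes; no; ¬?; _×-dec_; decidable-stable)
open import Relation.Nullary.Negation using (¬_; contradiction)
open import Relation.Unary using (Pred)
open import Defs

private variable
  n k : ℕ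
  G H K T U : Graph n
  S S′ : Subset n
  x y z : Fin n
  p : List (Fin n)

-- Cardinalities of finite subsets

x∉p-x : (p : Subset n) (x : Fin n) → x ∉ p - x
x∉p-x (_ ∷ p) zero    ()
x∉p-x (_ ∷ p) (suc x) (there x∈) = x∉p-x p x x∈

x∈p-y⇒x≢y : {p : Subset n} → x ∈ p - y → x ≢ y
x∈p-y⇒x≢y {p = p} x∈ refl = x∉p-x p _ x∈

x∈p⇒1≤∣p∣ : {p : Subset n} → x ∈ p → 1 ≤ ∣ p ∣
x∈p⇒1≤∣p∣ x∈p = ≤-trans (s≤s z≤n) (x∈p⇒∣p-x∣<∣p∣ x∈p)

-- Meant for neighbourhoods: at a leaf the neighbour is unique, and by the next lemma a vertex with
-- a neighbour that is not a leaf has a second one.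
∣p∣≡1⇒x≡y : {p : Subset n} → ∣ p ∣ ≡ 1 → x ∈ p → y ∈ p → x ≡ y
∣p∣≡1⇒x≡y {x = x} {y = y} {p = p} ∣p∣≡1 x∈p y∈p = decidable-stable (x ≟ y) λ x≢y →
  ℕ.n≮n 1 (subst (1 ℕ.<_) ∣p∣≡1
    (≤-trans (s≤s (x∈p⇒1≤∣p∣ (x∈p∧x≢y⇒x∈p-y x∈p x≢y))) (x∈p⇒∣p-x∣<∣p∣ y∈p)))

∣p∣≢1⇒∃≢ : {p : Subset n} → ∣ p ∣ ≢ 1 → x ∈ p → ∃[ y ] y ∈ p × y ≢ x
∣p∣≢1⇒∃≢ {x = x} {p = p} ∣p∣≢1 x∈p
  with a , b , a∈p , b∈p , a≢b ← 2≤∣p∣⇒distinct p (ℕ.≤∧≢⇒< (x∈p⇒1≤∣p∣ x∈p) (≢-sym ∣p∣≢1))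
  with a ≟ x
... | no a≢x   = a , a∈p , a≢x
... | yes refl = b , b∈p , ≢-sym a≢b

-- Walks and paths

Walk : Graph n → Rel (Fin n) _
Walk G = Star (Edge G)

walk-sym : IsSimple G → Symmetric (Walk G)
walk-sym simple = reverse (IsSimple.edge-sym simple)

linked⇒star : ∀ {a r} {A : Set a} {R : Rel A r} {x y xs} →
              Linked R (x ∷ xs) → y ∈ˡ x ∷ xs → Star R x y
linked⇒star _       (here refl)         = ε
-- Splitting `y∈` forces the tail to be nonempty, which excludes `[-]`.
linked⇒star (e ∷ l) (there y∈@(here _))  = e ◅ linked⇒star l y∈
linked⇒star (e ∷ l) (there y∈@(there _)) = e ◅ linked⇒star l y∈

last⇒∈ : last p ≡ just x → x ∈ˡ p
last⇒∈ {p = _ ∷ []}    refl = here refl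
last⇒∈ {p = _ ∷ _ ∷ _} eq   = there (last⇒∈ eq)

path⇒walk : IsPath G x y p → Walk G x y
path⇒walk {p = _ ∷ _} w with refl ← IsPath.start w =
  linked⇒star (IsPath.edges w) (last⇒∈ (IsPath.end w))

path-cons : IsSimple G → Edge G x y → x ∉ˡ p → IsPath G y z p → IsPath G x z (x ∷ p)
path-cons {p = _ ∷ _} simple e x∉p w with refl ← IsPath.start w = record
  { vertices = proj₁ (IsSimple.edge⇒∈V simple e) ∷ vertices
  ; edges    = e ∷ edges
  ; distinct = ¬Any⇒All¬ _ x∉p ∷ distinct
  ; start    = refl
  ; end      = end
  } where open IsPath w

path-suffix : IsPath G y z p → x ∈ˡ p → ∃[ q ] IsPath G x z q
path-suffix {p = p} w (here refl) = p , record
  { vertices = vertices ; edges = edges ; distinct = distinct ; start = refl ; end = end }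
  where open IsPath w
path-suffix {p = _ ∷ _ ∷ _} w (there x∈p)
  with _ ∷ vs ← IsPath.vertices w | _ ∷ es ← IsPath.edges w | _ ∷ u ← IsPath.distinct w =
  path-suffix (record { vertices = vs ; edges = es ; distinct = u
                      ; start = refl ; end = IsPath.end w }) x∈p

-- Loop erasure: when the new start already lies on the path built from the rest of the walk, the
-- suffix from that occurrence replaces the detour.
walk⇒path : IsSimple G → x ∈ V G → Walk G x y → ∃[ p ] IsPath G x y p
walk⇒path {x = x} simple x∈V ε = x ∷ [] , record
  { vertices = x∈V ∷ [] ; edges = [-] ; distinct = [] ∷ [] ; start = refl ; end = refl }
walk⇒path {x = x} simple x∈V (e ◅ w)
  with p , π ← walk⇒path simple (proj₂ (IsSimple.edge⇒∈V simple e)) w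
  with MembershipDec._∈?_ _≟_ x p
... | yes x∈p = path-suffix π x∈p
... | no x∉p  = x ∷ p , path-cons simple e x∉p π

subgraph-trans : IsSubgraph H G → IsSubgraph G K → IsSubgraph H K
subgraph-trans H⊆G G⊆K = record
  { V⊆ = V⊆ G⊆K ∘ V⊆ H⊆G ; E⊆ = E⊆ G⊆K ∘ E⊆ H⊆G }
  where open IsSubgraph

path-mono : IsSubgraph H G → IsPath H x y p → IsPath G x y p
path-mono H⊆G w = record
  { vertices = All.map V⊆ vertices
  ; edges    = Linked.map E⊆ edges
  ; distinct = distinct
  ; start    = start
  ; end      = end
  } where open IsSubgraph H⊆G; open IsPath w

acyclic-mono : IsSubgraph H G → Acyclic G → Acyclic H
acyclic-mono H⊆G acyclic x y p w 3≤ e =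
  acyclic x y p (path-mono H⊆G w) 3≤ (IsSubgraph.E⊆ H⊆G e)

-- Deleting a vertex

-- The decision is an argument, so that a proof can first rewrite by `lookup∘tabulate` and then
-- split on it.
delete-row : Graph n → ∀ x z → Dec (x ≡ z) → Subset n
delete-row G _ _ (yes _) = ⊥
delete-row G x z (no _)  = lookup (adj G) x - z

_∖_ : Graph n → Fin n → Graph n
G ∖ z = mkGraph (V G - z) (tabulate λ x → delete-row G x z (x ≟ z))

∖-edge⁺ : Edge G x y → x ≢ z → y ≢ z → Edge (G ∖ z) x y
∖-edge⁺ {G = G} {x = x} {y = y} {z = z} e x≢z y≢z =
  subst (y ∈_) (sym (lookup∘tabulate (λ x → delete-row G x z (x ≟ z)) x)) row
  where
  row : y ∈ delete-row G x z (x ≟ z)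
  row with x ≟ z
  ... | yes x≡z = contradiction x≡z x≢z
  ... | no _    = x∈p∧x≢y⇒x∈p-y e y≢z

∖-edge⁻ : Edge (G ∖ z) x y → Edge G x y × x ≢ z × y ≢ z
∖-edge⁻ {G = G} {z = z} {x = x} {y = y} e =
  row (x ≟ z) (subst (y ∈_) (lookup∘tabulate (λ x → delete-row G x z (x ≟ z)) x) e)
  where
  row : (d : Dec (x ≡ z)) → y ∈ delete-row G x z d → Edge G x y × x ≢ z × y ≢ z
  row (yes _)  y∈ = contradiction y∈ ∉⊥
  row (no x≢z) y∈ = p─q⊆p _ _ y∈ , x≢z , x∈p-y⇒x≢y y∈

∖-subgraph : IsSubgraph (G ∖ z) G
∖-subgraph {G = G} = record { V⊆ = p─q⊆p _ _ ; E⊆ = proj₁ ∘ ∖-edge⁻ {G = G} }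

∖-simple : IsSimple G → IsSimple (G ∖ z)
∖-simple {G = G} {z = z} simple = record
  { edge⇒∈V = λ e → let e′ , x≢z , y≢z = ∖-edge⁻ {G = G} e ; x∈ , y∈ = edge⇒∈V e′ in
      x∈p∧x≢y⇒x∈p-y x∈ x≢z , x∈p∧x≢y⇒x∈p-y y∈ y≢z
  ; edge-sym = λ e → let e′ , x≢z , y≢z = ∖-edge⁻ {G = G} e in
      ∖-edge⁺ {G = G} (edge-sym e′) y≢z x≢z
  ; no-loops = no-loops ∘ proj₁ ∘ ∖-edge⁻ {G = G}
  } where open IsSimple simple

∖-linked : ∀ G → z ∉ˡ p → Linked (Edge G) p → Linked (Edge (G ∖ z)) p
∖-linked G z∉p [] = []
∖-linked G z∉p [-] = [-]
∖-linked G z∉p (e ∷ l) =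
  ∖-edge⁺ {G = G} e (λ { refl → z∉p (here refl) }) (λ { refl → z∉p (there (here refl)) }) ∷
  ∖-linked G (z∉p ∘ there) l

path⇒walk-∖ : z ∉ˡ p → IsPath G x y p → Walk (G ∖ z) x y
path⇒walk-∖ {p = _ ∷ _} {G = G} z∉p w with refl ← IsPath.start w =
  linked⇒star (∖-linked G z∉p (IsPath.edges w)) (last⇒∈ (IsPath.end w))

-- A walk that enters a leaf must leave it for the vertex it came from.

skip-leaf : IsSimple G → degree G z ≡ 1 → x ≢ z → y ≢ z → Walk G x y → Walk (G ∖ z) x y
skip-leaf simple deg x≢z y≢z ε = ε
skip-leaf {G = G} {z = z} simple deg x≢z y≢z (_◅_ {j = b} e w) with b ≟ z
... | no b≢z = ∖-edge⁺ {G = G} e x≢z b≢z ◅ skip-leaf simple deg b≢z y≢z w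
... | yes refl with w
...   | ε      = contradiction refl y≢z
...   | e′ ◅ w′ with refl ← ∣p∣≡1⇒x≡y deg (IsSimple.edge-sym simple e) e′ =
  skip-leaf simple deg x≢z y≢z w′

-- Pruning leaves outside `S`

∖-leaf-tree : IsTree T → IsLeaf T z → IsTree (T ∖ z)
∖-leaf-tree {T = T} {z = z} tree (_ , deg) = record
  { simple    = ∖-simple simple
  ; connected = λ x y x∈ y∈ → walk⇒path (∖-simple simple) x∈ $
      skip-leaf simple deg (x∈p-y⇒x≢y x∈) (x∈p-y⇒x≢y y∈) $
      path⇒walk (proj₂ (connected x y (p─q⊆p _ _ x∈) (p─q⊆p _ _ y∈)))
  ; acyclic   = acyclic-mono ∖-subgraph acyclic
  } where open IsTree tree

-- The ambient graph of the result is `T` itself, so the result records that `U` is a subgraph of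
-- `T`; disjointness passes to pruned trees through this. Each deletion lowers the number of
-- vertices, which justifies the recursion.
prune : ∀ T → IsTree T → S ⊆ V T → Acc ℕ._<_ ∣ V T ∣ → ∃[ U ] IsSteinerTree T S U
prune {S = S} T tree S⊆V (acc smaller)
  with any? (λ x → isLeaf? T x ×-dec ¬? (x ∈? S))
... | no ¬∃ = T , record
  { subgraph = record { V⊆ = λ x∈ → x∈ ; E⊆ = λ e → e }
  ; tree     = tree
  ; S⊆V      = S⊆V
  ; leaf⇒∈S  = λ x leaf → decidable-stable (x ∈? S) λ x∉S → ¬∃ (x , leaf , x∉S)
  }
... | yes (z , leaf@(z∈V , _) , z∉S)
  with U , steiner ← prune (T ∖ z) (∖-leaf-tree tree leaf)
                       (λ x∈S → x∈p∧x≢y⇒x∈p-y (S⊆V x∈S) λ { refl → z∉S x∈S })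
                       (smaller (x∈p⇒∣p-x∣<∣p∣ z∈V)) =
  U , record
  { subgraph = subgraph-trans (IsSteinerTree.subgraph steiner) ∖-subgraph
  ; tree     = IsSteinerTree.tree steiner
  ; S⊆V      = IsSteinerTree.S⊆V steiner
  ; leaf⇒∈S  = IsSteinerTree.leaf⇒∈S steiner
  }

-- Separation of S by a vertex outside S

-- Such a walk contains a path from `x` to `y` that avoids `z`. It has at least two vertices because
-- `x ≢ y`, so putting `z` in front closes a cycle.
neighbours-separated : IsTree T → Edge T z x → Edge T z y → x ≢ y → ¬ Walk (T ∖ z) x y
neighbours-separated {T = T} {z = z} {x = x} {y = y} tree ex ey x≢y w =
  let p , π = walk⇒path (∖-simple simple) x∈V w in
  acyclic z y (z ∷ p)
    (path-cons simple ex (λ z∈p → x∉p-x (V T) z (All.lookup (IsPath.vertices π) z∈p))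
      (path-mono ∖-subgraph π))
    (3≤ p π) (edge-sym ey)
  where
  open IsTree tree
  open IsSimple simple

  x∈V : x ∈ V (T ∖ z)
  x∈V = x∈p∧x≢y⇒x∈p-y (proj₂ (edge⇒∈V ex)) λ { refl → no-loops ex }

  3≤ : ∀ p → IsPath (T ∖ z) x y p → 3 ≤ length (z ∷ p)
  3≤ []          π with () ← IsPath.start π
  3≤ (_ ∷ [])    π with refl ← IsPath.start π | refl ← IsPath.end π = contradiction refl x≢y
  3≤ (_ ∷ _ ∷ _) _ = s≤s (s≤s (s≤s z≤n))

-- A vertex outside `S` is not a leaf, and the given edge excludes degree zero.
other-neighbour : IsSteinerTree G S T → x ∉ S → Edge T x y → ∃[ z ] Edge T x z × z ≢ y
other-neighbour steiner x∉S e =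
  ∣p∣≢1⇒∃≢ (λ deg → x∉S (leaf⇒∈S _ (proj₁ (IsSimple.edge⇒∈V simple e) , deg))) e
  where open IsSteinerTree steiner; open IsTree tree

-- The path is extended at its head x, and m bounds the number of remaining
-- extensions, as a path has at most n vertices.

extend-to-S : ∀ {n} {G T : Graph n} {S : Subset n} {z} →
              IsSteinerTree G S T → ∀ m {x y p} →
              n ℕ.< m + length (x ∷ y ∷ p) →
              Linked (Edge T) (x ∷ y ∷ p) → Unique (x ∷ y ∷ p) → z ∈ˡ y ∷ p →
              ∃[ s ] s ∈ S × Walk (T ∖ z) x s
extend-to-S steiner zero    n< _ u _ = contradiction (unique⇒length≤ u) (ℕ.<⇒≱ n<)
extend-to-S {n} {T = T} {S} {z} steiner (suc m) {x} {y} {p} n< l@(e ∷ l′) u@(x∉ ∷ _) z∈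
  with x ∈? S
... | yes x∈S = x , x∈S , ε
... | no x∉S
  with v , ev , v≢y ← other-neighbour steiner x∉S e =
  let s , s∈S , w = extend-to-S steiner m (subst (n ℕ.<_) (sym (ℕ.+-suc m _)) n<)
                      (edge-sym ev ∷ l) (¬Any⇒All¬ _ v∉ ∷ u) (there z∈)
  -- Since `z` stays in the tail of a path without repetitions, neither the head `x` nor the new
  -- vertex `v` is `z`.
  in s , s∈S , ∖-edge⁺ {G = T} ev x≢z (λ { refl → v∉ (there z∈) }) ◅ w
  where
  open IsSteinerTree steiner
  open IsTree tree
  open IsSimple simple

  x≢z : x ≢ z
  x≢z = All.lookup x∉ z∈

  v∉ : v ∉ˡ x ∷ y ∷ p
  v∉ (here refl) = no-loops ev
  -- If `v` were on the tail, the stretch from `y` to `v` would join two neighbours of `x` while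
  -- avoiding `x`.
  v∉ (there v∈)  = neighbours-separated tree e ev (≢-sym v≢y)
    (linked⇒star (∖-linked T (All¬⇒¬Any x∉) l′) v∈)

S-separated : ∀ {n} {G T : Graph n} {S : Subset n} {z} →
              IsSteinerTree G S T → 2 ≤ ∣ S ∣ → z ∈ V T → z ∉ S →
              ∃₂ λ s t → s ∈ S × t ∈ S × ¬ Walk (T ∖ z) s t
S-separated {n} {T = T} {S} {z} steiner 2≤∣S∣ z∈V z∉S
  -- A member of `S` differs from `z`, so the path from `z` to it starts with an edge at `z`.
  with a , a∈S ← 1≤∣p∣⇒nonempty S (ℕ.<⇒≤ 2≤∣S∣)
  with u , eu ← path⇒neighbour {G = T} (λ { refl → z∉S a∈S })
                  (proj₂ (IsTree.connected (IsSteinerTree.tree steiner) z a z∈V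
                           (IsSteinerTree.S⊆V steiner a∈S)))
  with v , ev , v≢u ← other-neighbour steiner z∉S eu =
  let s , s∈S , u⇝s = reach eu
      t , t∈S , v⇝t = reach ev
  -- A walk from `s` to `t` avoiding `z` would connect the neighbours `u` and `v` without `z`.
  in s , t , s∈S , t∈S , λ s⇝t →
     neighbours-separated tree eu ev (≢-sym v≢u)
       (u⇝s ◅◅ s⇝t ◅◅ walk-sym (∖-simple simple) v⇝t)
  where
  open IsSteinerTree steiner
  open IsTree tree
  open IsSimple simple

  reach : ∀ {u} → Edge T z u → ∃[ s ] s ∈ S × Walk (T ∖ z) u s
  -- The initial path consists of `u` and `z`, headed at `u`; the bound `n` is enough because `n`
  -- plus its length exceeds `n`.
  reach e = extend-to-S steiner n (ℕ.m<m+n n (s≤s z≤n)) (edge-sym e ∷ [-])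
    (((λ { refl → no-loops e }) ∷ []) ∷ [] ∷ []) (here refl)

-- From `¬ P a b` the covering gives `Q a b`. For any `y` in `D`, if `P a y` then `P b y` fails, so
-- `Q b y` and hence `Q a y`; otherwise `Q a y` at once. So `Q` relates `a` to both `c` and `d`,
-- against `¬ Q c d`. The covering is stated with negations, so neither relation has to be decided.
not-covered : ∀ {a ℓ ℓ₁ ℓ₂} {A : Set a} {D : Pred A ℓ} {P : Rel A ℓ₁} {Q : Rel A ℓ₂} →
              Symmetric P → Transitive P → Symmetric Q → Transitive Q →
              (∃₂ λ x y → D x × D y × ¬ P x y) → (∃₂ λ x y → D x × D y × ¬ Q x y) →
              ¬ (∀ x y → D x → D y → ¬ (¬ P x y × ¬ Q x y))
not-covered {D = D} {Q = Q} P-sym P-trans Q-sym Q-trans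
            (a , b , Da , Db , ¬Pab) (c , d , Dc , Dd , ¬Qcd) covered =
  covered a b Da Db (¬Pab , λ Qab →
    ¬¬Qa c Dc λ Qac → ¬¬Qa d Dd λ Qad → ¬Qcd (Q-trans (Q-sym Qac) Qad))
  where
  ¬¬Qa : ∀ y → D y → ¬ ¬ Q a y
  ¬¬Qa y Dy ¬Qay =
    covered a y Da Dy ((λ Pay →
      covered a b Da Db (¬Pab , λ Qab →
        covered b y Db Dy ((λ Pby → ¬Pab (P-trans Pay (P-sym Pby))) ,
                           λ Qby → ¬Qay (Q-trans Qab Qby)))) , ¬Qay)

-- A path that missed `z` would be a walk in the tree with `z` deleted.
separated⇒internal : IsPath T x y p → x ≢ z → y ≢ z → ¬ Walk (T ∖ z) x y →
                     Internal x y p z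
separated⇒internal {p = p} {z = z} π x≢z y≢z sep =
  decidable-stable (MembershipDec._∈?_ _≟_ z p) (λ z∉p → sep (path⇒walk-∖ z∉p π)) ,
  ≢-sym x≢z , ≢-sym y≢z

-- Restricting a family to a smaller terminal set

-- Edges and paths of `T′` and `U′` are edges and paths of `T` and `U`, so both disjointness
-- conditions are inherited. The substance is `V∩V⊆S`: pruning must leave no common vertex outside
-- `S`.
restrict-independent : {T U T′ U′ : Graph n} → 2 ≤ ∣ S ∣ → S ⊆ S′ →
                       IsSteinerTree T S T′ → IsSteinerTree U S U′ →
                       IndependentPair S′ T U → IndependentPair S T′ U′
restrict-independent {S = S} {T′ = T′} {U′ = U′} 2≤∣S∣ S⊆S′ steinerT steinerU pair = record
  { edge-disjoint       = λ x y (e , f) → edge-disjoint x y (T.E⊆ e , U.E⊆ f)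
  ; V∩V≡S               = ⊆-antisym V∩V⊆S λ x∈S → x∈p∩q⁺ (T.S⊆V x∈S , U.S⊆V x∈S)
  ; internally-disjoint = disjoint
  }
  where
  open IndependentPair pair
  module T where
    open IsSteinerTree steinerT public
    open IsSubgraph subgraph public
    open IsTree tree public
  module U where
    open IsSteinerTree steinerU public
    open IsSubgraph subgraph public
    open IsTree tree public

  disjoint : ∀ x y → x ∈ S → y ∈ S → ∀ p q → IsPath T′ x y p → IsPath U′ x y q →
             ∀ z → ¬ (Internal x y p z × Internal x y q z)
  disjoint x y x∈S y∈S p q π ρ =
    internally-disjoint x y (S⊆S′ x∈S) (S⊆S′ y∈S) p q
      (path-mono T.subgraph π) (path-mono U.subgraph ρ)

  V∩V⊆S : V T′ ∩ V U′ ⊆ S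
  V∩V⊆S {z} z∈ = decidable-stable (z ∈? S) λ z∉S →
    let z∈T , z∈U = x∈p∩q⁻ (V T′) (V U′) z∈
        ≢z : ∀ {x} → x ∈ S → x ≢ z
        ≢z = λ { x∈S refl → z∉S x∈S }
    -- The two relations are connection by walks avoiding `z` in `T′` and in `U′`; a pair in neither
    -- would contradict `disjoint` at `z`.
    in not-covered
         (walk-sym (∖-simple T.simple)) _◅◅_ (walk-sym (∖-simple U.simple)) _◅◅_
         (S-separated steinerT 2≤∣S∣ z∈T z∉S) (S-separated steinerU 2≤∣S∣ z∈U z∉S)
         λ x y x∈S y∈S (sepT , sepU) →
           let p , π = T.connected x y (T.S⊆V x∈S) (T.S⊆V y∈S)
               q , ρ = U.connected x y (U.S⊆V x∈S) (U.S⊆V y∈S)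
           in disjoint x y x∈S y∈S p q π ρ z
                ( separated⇒internal π (≢z x∈S) (≢z y∈S) sepT
                , separated⇒internal ρ (≢z x∈S) (≢z y∈S) sepU)

restrict-family : 2 ≤ ∣ S ∣ → S ⊆ S′ →
                  HasIndependentSteinerTrees G S′ k → HasIndependentSteinerTrees G S k
restrict-family {S = S} {G = G} 2≤∣S∣ S⊆S′ (Ts , steiner , independent) =
  tabulate pruned ,
  (λ i → subst (IsSteinerTree G S) (sym (lookup∘tabulate pruned i)) (pruned-steiner i)) ,
  λ i j i<j →
    subst (λ T → IndependentPair S T (lookup (tabulate pruned) j))
          (sym (lookup∘tabulate pruned i)) $
    subst (IndependentPair S (pruned i)) (sym (lookup∘tabulate pruned j)) $
    restrict-independent 2≤∣S∣ S⊆S′ (proj₂ (prune-at i)) (proj₂ (prune-at j))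
      (independent i j i<j)
  where
  prune-at : ∀ i → ∃[ U ] IsSteinerTree (lookup Ts i) S U
  prune-at i = prune (lookup Ts i) tree (S⊆V ∘ S⊆S′) (<-wellFounded _)
    where open IsSteinerTree (steiner i)

  pruned : ∀ i → Graph _
  pruned = proj₁ ∘ prune-at

  pruned-steiner : ∀ i → IsSteinerTree G S (pruned i)
  pruned-steiner i = record
    { subgraph = subgraph-trans subgraph (IsSteinerTree.subgraph (steiner i))
    ; tree     = tree
    ; S⊆V      = S⊆V
    ; leaf⇒∈S  = leaf⇒∈S
    } where open IsSteinerTree (proj₂ (prune-at i))

theorem2p2 : ∀ {n} (G : Graph n) → IsSimple G → Connected G →
    ∀ (S S′ : Subset n) → S ⊆ V G → S′ ⊆ V G →
    (2≤∣S∣ : 2 ≤ ∣ S ∣) (S⊂S′ : S ⊂ S′) →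
    (∀ k → HasIndependentSteinerTrees G S′ k → HasIndependentSteinerTrees G S k)
    × κ* G S 2≤∣S∣ ≥ κ* G S′ (≤-trans 2≤∣S∣ (p⊆q⇒∣p∣≤∣q∣ (proj₁ S⊂S′)))
theorem2p2 G _ _ S S′ _ _ 2≤∣S∣ (S⊆S′ , _) =
  -- A family attaining the maximum for `S′` restricts to one of the same size for `S`, which the
  -- maximum for `S` bounds.
  restrict , S-maximal _ (restrict _ S′-attained)
  where
  restrict : ∀ k → HasIndependentSteinerTrees G S′ k → HasIndependentSteinerTrees G S k
  restrict _ = restrict-family 2≤∣S∣ S⊆S′

  S-maximal = proj₂ (proj₂ (κ*-maximum G S 2≤∣S∣))
  S′-attained = proj₁ (proj₂ (κ*-maximum G S′ (≤-trans 2≤∣S∣ (p⊆q⇒∣p∣≤∣q∣ S⊆S′))))
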